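{- Let $R=(b_1,b_2)$ be a reduced basis of a two-dimensional lattice in $\mathbb{R}^2$, put $m=(b_2,b_1)/(b_1,b_1)$, let $k$ be a positive integer, and let $x_1,\dots,x_{k+1}$ be integers such that the word $\omega=T^{x_{k+1}}\prod_{i=k}^{1}ST^{x_i}$ is Gaussian (relative to $R$). Then the following properties hold: (1) if $|b_1|<|b_2|$ and $m\ge 0$, then $\ell(\omega R)\ge \ell((ST^{ -2})^{k-1}\,S\,R)$; (2) if $|b_1|<|b_2|$ and $-1/2<m<0$, then $\ell(\omega R)\ge \ell((ST^{2})^{k-1}\,S\,R)$; (3) if $|b_1|<|b_2|$ and $m=-1/2$, then $\ell(\omega R)\ge \ell((ST^{ -2})^{k-1}\,ST\,R)$; (4) if $|b_1|=|b_2|$, then $\ell(\omega R)\ge \ell((ST^{ -2})^{k-1}\,ST^{ -1}\,R)$.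
   Context: A basis $B=(b_1,b_2)$ of a two-dimensional lattice in $\mathbb{R}^2$ is identified with the $2\times2$ real matrix whose rows are $b_1,b_2$. $(\cdot,\cdot)$ is the usual scalar product, $|\cdot|$ the Euclidean norm. The length of $B$ is $\ell(B)=|b_1|^2+|b_2|^2$. With $m=(b_2,b_1)/(b_1,b_1)$, the basis is proper if $-1/2\le m<1/2$, and reduced if it is proper and $|b_1|\le|b_2|$. $S=\begin{pmatrix}0&1\\1&0\end{pmatrix}$, $T=\begin{pmatrix}1&0\\1&1\end{pmatrix}$, and $\prod_{i=k}^1 ST^{x_i}$ means $ST^{x_k}ST^{x_{k-1}}\cdots ST^{x_1}$. Gaussian algorithm: on input a basis $B=(b_1,b_2)$, repeat: replace $b_2$ by $b_2-xb_1$, where $x$ is the integer nearest to $m$, chosen so that the new basis is proper (i.e. $B\mapsto T^{ -x}B$); then, if $|b_1|>|b_2|$, swap $b_1$ and $b_2$ (i.e. $B\mapsto SB$) and iterate; otherwise stop. If the successive translation integers are $x_{k+1},x_k,\dots,x_1$ (with a swap between consecutive translations), the execution is recorded by the word $T^{x_{k+1}}ST^{x_k}\cdots ST^{x_1}$. A word $\omega=T^{x_{k+1}}\prod_{i=k}^{1}ST^{x_i}$ is Gaussian (relative to the reduced basis $R$) if it is exactly the word recorded by the Gaussian algorithm when run on the input basis $\omega R$. -}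

module Defs where

open import Algebra.Apartness.Bundles using (HeytingField)
open import Algebra.Bundles using (CommutativeRing)
open import Algebra.Solver.Ring.AlmostCommutativeRing
  using (fromCommutativeRing; _-Raw-AlmostCommutative⟶_)
open import Data.Empty using (⊥-elim)
open import Data.Integer as ℤ using (ℤ; +_; -[1+_]; +[1+_])
import Data.Integer.Properties as ℤ
open import Data.List using (List; []; _∷_; _++_; concat; replicate; foldr)
open import Data.Maybe using (map)
open import Data.Nat as ℕ using (ℕ; zero; suc)
open import Data.Product using (∃-syntax; _×_; _,_; proj₁; proj₂)
open import Data.Sign as Sign using ()
open import Data.Sum using (_⊎_; inj₁; inj₂; [_,_]′)
open import Function.Base using (id; _∘_)
open import Function.Bundles using (_⇔_; module Equivalence)
open import Level using (_⊔_) renaming (suc to lsuc)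
open import Relation.Binary.Core using (Rel)
import Relation.Binary.PropositionalEquality as ≡
open import Relation.Binary.Structures using (IsStrictPartialOrder)
open import Relation.Nullary using (¬_)
open import Relation.Nullary.Decidable using (dec⇒maybe)
open import Relation.Unary using (Pred; Satisfiable; _∈_)
import Algebra.Properties.Monoid.Mult.TCOptimised
import Algebra.Properties.Semiring.Mult.TCOptimised
import Algebra.Apartness.Properties.HeytingCommutativeRing
import Algebra.Properties.Ring
import Algebra.Solver.Ring
import Relation.Binary.Reasoning.Setoid

-- The real numbers, given axiomatically as a complete Archimedean ordered
-- field.  Order decidability is not assumed, so that constructive reals are
-- a model; classically `complete` is Dedekind's cut axiom and any two models
-- are isomorphic.
record RealField c ℓ₁ ℓ₂ : Set (lsuc (c ⊔ ℓ₁ ⊔ ℓ₂)) where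
  field
    heytingField : HeytingField c ℓ₁ ℓ₂

  open HeytingField heytingField public

  commutativeRing : CommutativeRing c ℓ₁
  commutativeRing = record { isCommutativeRing = isCommutativeRing }

  open CommutativeRing commutativeRing public using (semiring; ring)
  open Algebra.Properties.Semiring.Mult.TCOptimised semiring public
    using () renaming (_×_ to _×ₙ_)

  fromℕ : ℕ → Carrier
  fromℕ n = n ×ₙ 1#

  infix 4 _<_ _≤_
  field
    _<_                  : Rel Carrier ℓ₂
    isStrictPartialOrder : IsStrictPartialOrder _≈_ _<_
    #⇔<⊎>                : ∀ {x y} → x # y ⇔ (x < y ⊎ y < x)
    +-monoʳ-<            : ∀ x {y z} → y < z → x + y < x + z
    *-pos                : ∀ {x y} → 0# < x → 0# < y → 0# < x * y

  _≤_ : Rel Carrier ℓ₂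
  x ≤ y = ¬ (y < x)

  field
    archimedean : ∀ x → ∃[ n ] x < fromℕ n
    complete    : (L U : Pred Carrier ℓ₂) → Satisfiable L → Satisfiable U →
                  (∀ {x y} → x ∈ L → y ∈ U → x ≤ y) →
                  (∀ {x y} → x < y → x ∈ L ⊎ y ∈ U) →
                  ∃[ s ] (∀ {x} → x ∈ L → x ≤ s) × (∀ {y} → y ∈ U → s ≤ y)

module RealFieldProperties {c ℓ₁ ℓ₂} (ℝ : RealField c ℓ₁ ℓ₂) where

  open RealField ℝ
  open Algebra.Apartness.Properties.HeytingCommutativeRing
    (HeytingField.heytingCommutativeRing heytingField) public
    using (1#0; #-congʳ; #-congˡ; x-0≈x)
  open Algebra.Properties.Ring ring using (-‿distribˡ-*; -‿distribʳ-*; -‿+-comm; -‿involutive; -0#≈0#)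
  open IsStrictPartialOrder isStrictPartialOrder public
    using (<-resp-≈) renaming (irrefl to <-irrefl; trans to <-trans)
  private module M where
    open Algebra.Properties.Semiring.Mult.TCOptimised semiring public
  open Relation.Binary.Reasoning.Setoid setoid

  fromℤ : ℤ → Carrier
  fromℤ (+ n)    = fromℕ n
  fromℤ -[1+ n ] = - fromℕ (suc n)

  private
    cancel : ∀ x y z → (x + y) - (x + z) ≈ y - z
    cancel x y z = begin
      (x + y) + - (x + z)      ≈⟨ +-congˡ (sym (-‿+-comm x z)) ⟩
      (x + y) + (- x + - z)    ≈⟨ +-congʳ (+-comm x y) ⟩
      (y + x) + (- x + - z)    ≈⟨ +-assoc y x _ ⟩
      y + (x + (- x + - z))    ≈⟨ +-congˡ (sym (+-assoc x (- x) (- z))) ⟩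
      y + ((x + - x) + - z)    ≈⟨ +-congˡ (+-congʳ (-‿inverseʳ x)) ⟩
      y + (0# + - z)           ≈⟨ +-congˡ (+-identityˡ _) ⟩
      y + - z                  ∎

    fromℤ-⊖ : ∀ m n → fromℤ (m ℤ.⊖ n) ≈ fromℕ m - fromℕ n
    fromℤ-⊖ m       zero    = sym (x-0≈x (fromℕ m))
    fromℤ-⊖ zero    (suc n) = sym (+-identityˡ _)
    fromℤ-⊖ (suc m) (suc n) = begin
      fromℤ (suc m ℤ.⊖ suc n)             ≡⟨ ≡.cong fromℤ (ℤ.[1+m]⊖[1+n]≡m⊖n m n) ⟩
      fromℤ (m ℤ.⊖ n)                     ≈⟨ fromℤ-⊖ m n ⟩
      fromℕ m - fromℕ n                   ≈⟨ sym (cancel 1# _ _) ⟩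
      (1# + fromℕ m) - (1# + fromℕ n)     ≈⟨ sym (+-cong (M.1+× m 1#) (-‿cong (M.1+× n 1#))) ⟩
      fromℕ (suc m) - fromℕ (suc n)       ∎

    fromℤ-+ : ∀ i j → fromℤ (i ℤ.+ j) ≈ fromℤ i + fromℤ j
    fromℤ-+ -[1+ m ] -[1+ n ] = begin
      - fromℕ (suc (suc (m ℕ.+ n)))         ≡⟨ ≡.cong (λ k → - fromℕ (suc k)) (≡.sym (+-suc m n)) ⟩
      - fromℕ (suc m ℕ.+ suc n)             ≈⟨ -‿cong (M.×-homo-+ 1# (suc m) (suc n)) ⟩
      - (fromℕ (suc m) + fromℕ (suc n))     ≈⟨ sym (-‿+-comm _ _) ⟩
      - fromℕ (suc m) + - fromℕ (suc n)     ∎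
      where open import Data.Nat.Properties using (+-suc)
    fromℤ-+ -[1+ m ] (+ n)    = trans (fromℤ-⊖ n (suc m)) (+-comm _ _)
    fromℤ-+ (+ m)    -[1+ n ] = fromℤ-⊖ m (suc n)
    fromℤ-+ (+ m)    (+ n)    = M.×-homo-+ 1# m n

    fromℤ-neg : ∀ i → fromℤ (ℤ.- i) ≈ - fromℤ i
    fromℤ-neg (+ zero)  = sym -0#≈0#
    fromℤ-neg +[1+ n ]  = refl
    fromℤ-neg -[1+ n ]  = sym (-‿involutive _)

    fromℤ-- : ∀ n → fromℤ (Sign.- ℤ.◃ n) ≈ - fromℕ n
    fromℤ-- zero    = sym -0#≈0#
    fromℤ-- (suc n) = refl

    fromℤ-* : ∀ i j → fromℤ (i ℤ.* j) ≈ fromℤ i * fromℤ j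
    fromℤ-* (+ m) (+ n) = trans (reflexive (≡.cong fromℤ (ℤ.+◃n≡+n (m ℕ.* n)))) (M.×1-homo-* m n)
    fromℤ-* (+ m) -[1+ n ] = begin
      fromℤ (Sign.- ℤ.◃ m ℕ.* suc n)   ≈⟨ fromℤ-- (m ℕ.* suc n) ⟩
      - fromℕ (m ℕ.* suc n)            ≈⟨ -‿cong (M.×1-homo-* m (suc n)) ⟩
      - (fromℕ m * fromℕ (suc n))      ≈⟨ -‿distribʳ-* _ _ ⟩
      fromℕ m * - fromℕ (suc n)        ∎
    fromℤ-* -[1+ m ] (+ n) = begin
      fromℤ (Sign.- ℤ.◃ suc m ℕ.* n)   ≈⟨ fromℤ-- (suc m ℕ.* n) ⟩
      - fromℕ (suc m ℕ.* n)            ≈⟨ -‿cong (M.×1-homo-* (suc m) n) ⟩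
      - (fromℕ (suc m) * fromℕ n)      ≈⟨ -‿distribˡ-* _ _ ⟩
      - fromℕ (suc m) * fromℕ n        ∎
    fromℤ-* -[1+ m ] -[1+ n ] = begin
      fromℕ (suc m ℕ.* suc n)              ≈⟨ M.×1-homo-* (suc m) (suc n) ⟩
      fromℕ (suc m) * fromℕ (suc n)        ≈⟨ sym (-‿involutive _) ⟩
      - - (fromℕ (suc m) * fromℕ (suc n))  ≈⟨ -‿cong (-‿distribˡ-* _ _) ⟩
      - (- fromℕ (suc m) * fromℕ (suc n))  ≈⟨ -‿distribʳ-* _ _ ⟩
      - fromℕ (suc m) * - fromℕ (suc n)    ∎

  fromℤ-morphism : ℤ.+-*-rawRing -Raw-AlmostCommutative⟶ fromCommutativeRing commutativeRing
  fromℤ-morphism = record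
    { ⟦_⟧ = fromℤ ; +-homo = fromℤ-+ ; *-homo = fromℤ-* ; -‿homo = fromℤ-neg
    ; 0-homo = refl ; 1-homo = refl }

  module Solver = Algebra.Solver.Ring ℤ.+-*-rawRing (fromCommutativeRing commutativeRing)
    fromℤ-morphism (λ i j → map (reflexive ∘ ≡.cong fromℤ) (dec⇒maybe (i ℤ.≟ j)))
  open Solver using (solve; _:=_; _:+_; _:*_; _:-_; con)

  <-respˡ : ∀ {x y z} → x ≈ y → x < z → y < z
  <-respˡ = proj₂ <-resp-≈

  <-respʳ : ∀ {x y z} → x ≈ y → z < x → z < y
  <-respʳ = proj₁ <-resp-≈

  <⇒# : ∀ {x y} → x < y → x # y
  <⇒# = Equivalence.from #⇔<⊎> ∘ inj₁

  pos⇒#0 : ∀ {x} → 0# < x → x # 0#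
  pos⇒#0 = #-sym ∘ <⇒#

  <-cotrans : ∀ {x y} → x < y → ∀ z → x < z ⊎ z < y
  <-cotrans x<y z with #-cotrans (<⇒# x<y) z
  ... | inj₁ x#z = [ inj₁ , (λ z<x → inj₂ (<-trans z<x x<y)) ]′ (Equivalence.to #⇔<⊎> x#z)
  ... | inj₂ z#y = [ inj₂ , (λ y<z → inj₁ (<-trans x<y y<z)) ]′ (Equivalence.to #⇔<⊎> z#y)

  <⇒≤ : ∀ {x y} → x < y → x ≤ y
  <⇒≤ x<y y<x = <-irrefl refl (<-trans x<y y<x)

  <⇒0<- : ∀ {x y} → x < y → 0# < y - x
  <⇒0<- {x} {y} x<y = <-respˡ (-‿inverseˡ x) (<-respʳ (+-comm (- x) y) (+-monoʳ-< (- x) x<y))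

  0<-⇒< : ∀ {x y} → 0# < y - x → x < y
  0<-⇒< {x} {y} p = <-respˡ (+-identityʳ x)
    (<-respʳ (solve 2 (λ x y → x :+ (y :- x) := y) refl x y) (+-monoʳ-< x p))

  abstract
    0<x+y : ∀ {x y} → 0# < x → 0# ≤ y → 0# < x + y
    0<x+y {x} {y} 0<x 0≤y = [ id , (λ x+y<x → ⊥-elim (0≤y (0<-⇒<
      (<-respʳ (solve 2 (λ x y → x :- (x :+ y) := con (+ 0) :- y) refl x y) (<⇒0<- x+y<x))))) ]′
      (<-cotrans 0<x (x + y))

    0≤x+y : ∀ {x y} → 0# ≤ x → 0# ≤ y → 0# ≤ x + y
    0≤x+y {x} {y} 0≤x 0≤y x+y<0 = [ (λ x+y<x → 0≤y (0<-⇒<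
      (<-respʳ (solve 2 (λ x y → x :- (x :+ y) := con (+ 0) :- y) refl x y) (<⇒0<- x+y<x)))) , 0≤x ]′
      (<-cotrans x+y<0 x)

    0<x² : ∀ {x} → x # 0# → 0# < x * x
    0<x² {x} x#0 with Equivalence.to #⇔<⊎> x#0
    ... | inj₂ 0<x = *-pos 0<x 0<x
    ... | inj₁ x<0 = <-respʳ
      (solve 1 (λ x → (con (+ 0) :- x) :* (con (+ 0) :- x) := x :* x) refl x)
      (*-pos (<⇒0<- x<0) (<⇒0<- x<0))

    #0-*ˡ : ∀ {x y} → x * y # 0# → y # 0#
    #0-*ˡ {x} {y} xy#0 with #⇒invertible xy#0
    ... | z , z*xy≈1 , _ = invertible⇒# (z * x , eq , trans (*-comm _ _) eq)
      where
      eq : z * x * (y - 0#) ≈ 1#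
      eq = trans (solve 3 (λ x y z → z :* x :* (y :- con (+ 0)) := z :* (x :* y :- con (+ 0))) refl x y z) z*xy≈1

    0≤x² : ∀ x → 0# ≤ x * x
    0≤x² x x²<0 = <-irrefl refl (<-trans x²<0 (0<x² (#0-*ˡ (<⇒# x²<0))))

    0<1 : 0# < 1#
    0<1 = <-respʳ (*-identityˡ 1#) (0<x² 1#0)

  infix 9 _⁻¹⟨_⟩
  opaque
    _⁻¹⟨_⟩ : ∀ x → x # 0# → Carrier
    x ⁻¹⟨ x#0 ⟩ = proj₁ (#⇒invertible x#0)

    *-inverseʳ : ∀ x (x#0 : x # 0#) → x * x ⁻¹⟨ x#0 ⟩ ≈ 1#
    *-inverseʳ x x#0 = trans (*-congʳ (sym (x-0≈x x))) (proj₂ (proj₂ (#⇒invertible x#0)))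

  ⁻¹-pos : ∀ {x} (0<x : 0# < x) → 0# < x ⁻¹⟨ pos⇒#0 0<x ⟩
  ⁻¹-pos {x} 0<x = [ (λ y<0 → ⊥-elim (<-irrefl refl (<-trans 0<1 (0<-⇒< (<-respʳ
      (trans (solve 2 (λ x y → x :* (con (+ 0) :- y) := con (+ 0) :- x :* y) refl x y)
             (+-congˡ (-‿cong (*-inverseʳ x x#0))))
      (*-pos 0<x (<⇒0<- y<0)))))))
    , id ]′ (Equivalence.to #⇔<⊎> (#0-*ˡ {x} (#-congʳ (sym (*-inverseʳ x x#0)) 1#0)))
    where
    x#0 = pos⇒#0 0<x
    y = x ⁻¹⟨ x#0 ⟩

  0<2 : 0# < 1# + 1#
  0<2 = 0<x+y 0<1 (<⇒≤ 0<1)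

  ½ : Carrier
  ½ = (1# + 1#) ⁻¹⟨ pos⇒#0 0<2 ⟩

module SquareRoot
  {c ℓ₁ ℓ₂} (ℝ : RealField c ℓ₁ ℓ₂)
  (a : RealField.Carrier ℝ) (0≤a : RealField._≤_ ℝ (RealField.0# ℝ) a)
  where

  open RealField ℝ
  open RealFieldProperties ℝ
  open Solver using (solve; _:=_; _:+_; _:*_; _:-_; con)
  open Relation.Binary.Reasoning.Setoid setoid

  L U : Pred Carrier ℓ₂
  L x = x < 0# ⊎ x * x < a
  U y = 0# < y × a < y * y

  private
    square-mono : ∀ {x y} → 0# < y + x → x < y → x * x < y * y
    square-mono {x} {y} p q = 0<-⇒< (<-respʳ
      (solve 2 (λ x y → (y :+ x) :* (y :- x) := y :* y :- x :* x) refl x y) (*-pos p (<⇒0<- q)))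

    -1<0 : - 1# < 0#
    -1<0 = 0<-⇒< (<-respʳ (solve 0 (con (+ 1) := con (+ 0) :- con (ℤ.- (+ 1))) refl) 0<1)

    0<1+a : 0# < 1# + a
    0<1+a = 0<x+y 0<1 0≤a

    U[1+a] : (1# + a) ∈ U
    U[1+a] = 0<1+a , 0<-⇒< (<-respʳ
      (solve 1 (λ a → con (+ 1) :+ (a :+ a :* a) := (con (+ 1) :+ a) :* (con (+ 1) :+ a) :- a) refl a)
      (0<x+y 0<1 (0≤x+y 0≤a (0≤x² a))))

    L≤U : ∀ {x y} → x ∈ L → y ∈ U → x ≤ y
    L≤U (inj₁ x<0)  (0<y , _)    y<x = <-irrefl refl (<-trans (<-trans 0<y y<x) x<0)
    L≤U (inj₂ x²<a) (0<y , a<y²) y<x = <-irrefl refl (<-trans (<-trans x²<a a<y²)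
      (square-mono (0<x+y (<-trans 0<y y<x) (<⇒≤ 0<y)) y<x))

    located : ∀ {x y} → x < y → x ∈ L ⊎ y ∈ U
    located {x} {y} x<y with <-cotrans x<y 0#
    ... | inj₁ x<0 = inj₁ (inj₁ x<0)
    ... | inj₂ 0<y with <-cotrans (0<-⇒< {0# - y} {0#}
            (<-respʳ (solve 1 (λ y → y := con (+ 0) :- (con (+ 0) :- y)) refl y) 0<y)) x
    ...   | inj₂ x<0  = inj₁ (inj₁ x<0)
    ...   | inj₁ -y<x with <-cotrans (square-mono (<-respʳ
              (solve 2 (λ x y → x :- (con (+ 0) :- y) := y :+ x) refl x y) (<⇒0<- -y<x)) x<y) a
    ...     | inj₁ x²<a = inj₁ (inj₂ x²<a)
    ...     | inj₂ a<y² = inj₂ (0<y , a<y²)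

    cut = complete L U (- 1# , inj₁ -1<0) (1# + a , U[1+a]) L≤U located

  s : Carrier
  s = proj₁ cut

  private
    L≤s : ∀ {x} → x ∈ L → x ≤ s
    L≤s = proj₁ (proj₂ cut)

    s≤U : ∀ {y} → y ∈ U → s ≤ y
    s≤U = proj₂ (proj₂ cut)

  0≤s : 0# ≤ s
  0≤s s<0 = L≤s (inj₁ (0<-⇒< (<-respʳ
      (solve 2 (λ s h → (con (+ 0) :- s) :* h := con (+ 0) :- s :* h) refl s ½) 0<-s½)))
    (0<-⇒< (<-respʳ (begin
      (0# - s) * ½                  ≈⟨ solve 2 (λ s h → (con (+ 0) :- s) :* h :=
                                          s :* h :- s :* ((con (+ 1) :+ con (+ 1)) :* h)) refl s ½ ⟩
      s * ½ - s * ((1# + 1#) * ½)   ≈⟨ +-congˡ (-‿cong (*-congˡ (*-inverseʳ (1# + 1#) _))) ⟩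
      s * ½ - s * 1#                ≈⟨ +-congˡ (-‿cong (*-identityʳ s)) ⟩
      s * ½ - s                     ∎) 0<-s½))
    where
    0<-s½ : 0# < (0# - s) * ½
    0<-s½ = *-pos (<⇒0<- s<0) (⁻¹-pos 0<2)

  private
    s²≮a : ¬ (s * s < a)
    s²≮a s²<a = L≤s (inj₂ (0<-⇒< (<-respʳ eq₂ (*-pos 0<δ 0<1+e-δ))))
                    (0<-⇒< (<-respʳ (solve 2 (λ s d → d := (s :+ d) :- s) refl s δ) 0<δ))
      where
      e = a - s * s
      0<e : 0# < e
      0<e = <⇒0<- s²<a
      D = 1# + e + (s + s)
      0<1+e : 0# < 1# + e
      0<1+e = 0<x+y 0<1 (<⇒≤ 0<e)
      0<D : 0# < D
      0<D = 0<x+y 0<1+e (0≤x+y 0≤s 0≤s)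
      i = D ⁻¹⟨ pos⇒#0 0<D ⟩
      0<i : 0# < i
      0<i = ⁻¹-pos 0<D
      D*i≈1 : D * i ≈ 1#
      D*i≈1 = *-inverseʳ D _
      δ = e * i
      0<δ : 0# < δ
      0<δ = *-pos 0<e 0<i
      0≤s[1+e] : 0# ≤ s * (1# + e)
      0≤s[1+e] p = 0≤s (0<-⇒< (<-respʳ (begin
        (0# - s * (1# + e)) * j   ≈⟨ solve 3 (λ s f j → (con (+ 0) :- s :* f) :* j :=
                                       con (+ 0) :- s :* (f :* j)) refl s (1# + e) j ⟩
        0# - s * ((1# + e) * j)   ≈⟨ +-congˡ (-‿cong (trans (*-congˡ (*-inverseʳ _ _)) (*-identityʳ s))) ⟩
        0# - s                    ∎) (*-pos (<⇒0<- p) (⁻¹-pos 0<1+e))))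
        where j = (1# + e) ⁻¹⟨ pos⇒#0 0<1+e ⟩
      eq₁ : i * (1# + e + e * e + (s * (1# + e) + s * (1# + e))) ≈ 1# + e - δ
      eq₁ = begin
        i * (1# + e + e * e + (s * (1# + e) + s * (1# + e)))
          ≈⟨ solve 3 (λ i e s → i :* (con (+ 1) :+ e :+ e :* e :+ (s :* (con (+ 1) :+ e) :+ s :* (con (+ 1) :+ e)))
               := (con (+ 1) :+ e) :* ((con (+ 1) :+ e :+ (s :+ s)) :* i) :- e :* i) refl i e s ⟩
        (1# + e) * (D * i) - δ   ≈⟨ +-congʳ (trans (*-congˡ D*i≈1) (*-identityʳ _)) ⟩
        1# + e - δ               ∎
      0<1+e-δ : 0# < 1# + e - δ
      0<1+e-δ = <-respʳ eq₁ (*-pos 0<i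
        (0<x+y (0<x+y 0<1+e (0≤x² e)) (0≤x+y 0≤s[1+e] 0≤s[1+e])))
      eq₂ : δ * (1# + e - δ) ≈ a - (s + δ) * (s + δ)
      eq₂ = begin
        δ * (1# + e - δ)
          ≈⟨ solve 3 (λ e i s → e :* i :* (con (+ 1) :+ e :- e :* i) :=
               e :* ((con (+ 1) :+ e :+ (s :+ s)) :* i) :+ s :* s :- (s :+ e :* i) :* (s :+ e :* i)) refl e i s ⟩
        e * (D * i) + s * s - (s + δ) * (s + δ)
          ≈⟨ +-congʳ (+-congʳ (trans (*-congˡ D*i≈1) (*-identityʳ e))) ⟩
        a - s * s + s * s - (s + δ) * (s + δ)
          ≈⟨ +-congʳ (solve 2 (λ a q → a :- q :+ q := a) refl a (s * s)) ⟩
        a - (s + δ) * (s + δ) ∎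

    below : 0# < s → a < s * s → ∃[ y ] y ∈ U × y < s
    below 0<s a<s² = y , (0<y , a<y²) , 0<-⇒< (<-respʳ ej≈s-y 0<ej)
      where
      0<2s : 0# < s + s
      0<2s = 0<x+y 0<s 0≤s
      j = (s + s) ⁻¹⟨ pos⇒#0 0<2s ⟩
      0<j : 0# < j
      0<j = ⁻¹-pos 0<2s
      2s*j≈1 : (s + s) * j ≈ 1#
      2s*j≈1 = *-inverseʳ (s + s) _
      e = s * s - a
      0<ej : 0# < e * j
      0<ej = *-pos (<⇒0<- a<s²) 0<j
      y = (s * s + a) * j
      0<y : 0# < y
      0<y = *-pos (0<x+y (*-pos 0<s 0<s) 0≤a) 0<j
      ej≈s-y : e * j ≈ s - y
      ej≈s-y = begin
        e * j                  ≈⟨ solve 3 (λ s a j → (s :* s :- a) :* j :=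
                                    s :* ((s :+ s) :* j) :- (s :* s :+ a) :* j) refl s a j ⟩
        s * ((s + s) * j) - y  ≈⟨ +-congʳ (trans (*-congˡ 2s*j≈1) (*-identityʳ s)) ⟩
        s - y                  ∎
      a<y² : a < y * y
      a<y² = 0<-⇒< (<-respʳ (begin
        e * j * (e * j)
          ≈⟨ solve 3 (λ s a j → (s :* s :- a) :* j :* ((s :* s :- a) :* j) :=
               (s :* s :+ a) :* j :* ((s :* s :+ a) :* j)
                 :- a :* (((s :+ s) :* j) :* ((s :+ s) :* j))) refl s a j ⟩
        y * y - a * (((s + s) * j) * ((s + s) * j))
          ≈⟨ +-congˡ (-‿cong (*-congˡ (trans (*-cong 2s*j≈1 2s*j≈1) (*-identityʳ 1#)))) ⟩
        y * y - a * 1#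
          ≈⟨ +-congˡ (-‿cong (*-identityʳ a)) ⟩
        y * y - a ∎) (*-pos 0<ej 0<ej))

    a≮s² : ¬ (a < s * s)
    a≮s² a<s² = ¬¬0<s λ 0<s → let y , y∈U , y<s = below 0<s a<s² in s≤U y∈U y<s
      where
      0<s² : 0# < s * s
      0<s² = [ ⊥-elim ∘ 0≤a , id ]′ (<-cotrans a<s² 0#)
      ¬¬0<s : ¬ ¬ (0# < s)
      ¬¬0<s k = [ 0≤s , k ]′ (Equivalence.to #⇔<⊎> (#0-*ˡ (pos⇒#0 0<s²)))

  s²≈a : s * s ≈ a
  s²≈a = proj₁ (tight (s * s) a) ([ s²≮a , a≮s² ]′ ∘ Equivalence.to #⇔<⊎>)

data Letter : Set where
  S  : Letter
  T^ : ℤ → Letter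

Word : Set
Word = List Letter

infixl 8 _^_
_^_ : Word → ℕ → Word
w ^ n = concat (replicate n w)

ST^ : ℤ → Word
ST^ x = S ∷ T^ x ∷ []

-- ∏ST^ k x is the word ST^(x k) ST^(x (k-1)) ⋯ ST^(x 1); x 0 is not used.
∏ST^ : ℕ → (ℕ → ℤ) → Word
∏ST^ zero    x = []
∏ST^ (suc k) x = ST^ (x (suc k)) ++ ∏ST^ k x

module LatticeReduction {c ℓ₁ ℓ₂} (ℝ : RealField c ℓ₁ ℓ₂) where

  open RealField ℝ
  open RealFieldProperties ℝ
  open Solver using (solve; _:=_; _:+_; _:*_; _:-_; con)

  opaque
    √ : ∀ a → 0# ≤ a → Carrier
    √ = SquareRoot.s ℝ

    √-nonneg : ∀ a 0≤a → 0# ≤ √ a 0≤a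
    √-nonneg = SquareRoot.0≤s ℝ

    √-square : ∀ a 0≤a → √ a 0≤a * √ a 0≤a ≈ a
    √-square = SquareRoot.s²≈a ℝ

  Vector : Set c
  Vector = Carrier × Carrier

  infixl 7 _∙_ _•_
  infixl 6 _⊕_

  _∙_ : Vector → Vector → Carrier
  (x , y) ∙ (u , v) = x * u + y * v

  _•_ : Carrier → Vector → Vector
  r • (x , y) = r * x , r * y

  _⊕_ : Vector → Vector → Vector
  (x , y) ⊕ (u , v) = x + u , y + v

  ∣_∣ : Vector → Carrier
  ∣ v@(x , y) ∣ = √ (v ∙ v) (0≤x+y (0≤x² x) (0≤x² y))

  -- A matrix is the pair of its rows.
  Matrix : Set c
  Matrix = Vector × Vector

  infixr 7 _·_
  _·_ : Matrix → Matrix → Matrix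
  ((p , q) , (r , s)) · (u , v) = p • u ⊕ q • v , r • u ⊕ s • v

  -- T^ x is the x-th power of T = ((1 , 0) , (1 , 1)), for any integer x.
  ⟦_⟧ : Letter → Matrix
  ⟦ S ⟧    = (0# , 1#) , (1# , 0#)
  ⟦ T^ x ⟧ = (1# , 0#) , (fromℤ x , 1#)

  Nonzero : Vector → Set ℓ₂
  Nonzero (x , y) = x # 0# ⊎ y # 0#

  -- Linear independence of the rows, with apartness from zero in place of
  -- the (classically equivalent) negated equality.
  LinearlyIndependent : Matrix → Set (c ⊔ ℓ₂)
  LinearlyIndependent (u , v) = ∀ r s → Nonzero (r , s) → Nonzero (r • u ⊕ s • v)

  record Basis : Set (c ⊔ ℓ₂) where
    constructor basis
    field
      matrix      : Matrix
      independent : LinearlyIndependent matrix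

    b₁ b₂ : Vector
    b₁ = proj₁ matrix
    b₂ = proj₂ matrix

  open Basis public

  Nonzero-cong : ∀ {x x′ y y′} → x ≈ x′ → y ≈ y′ → Nonzero (x , y) → Nonzero (x′ , y′)
  Nonzero-cong p q = [ inj₁ ∘ #-congʳ p , inj₂ ∘ #-congʳ q ]′

  abstract
    ·-independent : ∀ l B → LinearlyIndependent B → LinearlyIndependent (⟦ l ⟧ · B)
    ·-independent S ((x , y) , (u , v)) indep r s nz =
      Nonzero-cong (eq x u) (eq y v) (indep s r ([ inj₂ , inj₁ ]′ nz))
      where
      eq : ∀ x u → s * x + r * u ≈ r * (0# * x + 1# * u) + s * (1# * x + 0# * u)
      eq = solve 4 (λ r s x u → s :* x :+ r :* u :=
        r :* (con (+ 0) :* x :+ con (+ 1) :* u) :+ s :* (con (+ 1) :* x :+ con (+ 0) :* u)) refl r s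
    ·-independent (T^ i) ((x , y) , (u , v)) indep r s nz =
      Nonzero-cong (eq x u) (eq y v) (indep (r + s * t) s (split nz))
      where
      t : Carrier
      t = fromℤ i
      eq : ∀ x u → (r + s * t) * x + s * u ≈ r * (1# * x + 0# * u) + s * (t * x + 1# * u)
      eq = solve 5 (λ r s t x u → (r :+ s :* t) :* x :+ s :* u :=
        r :* (con (+ 1) :* x :+ con (+ 0) :* u) :+ s :* (t :* x :+ con (+ 1) :* u)) refl r s t
      -- r # 0 splits into r # r + s * t, hence s * t # 0, or r + s * t # 0.
      split : Nonzero (r , s) → Nonzero (r + s * t , s)
      split (inj₂ s#0) = inj₂ s#0
      split (inj₁ r#0) with #-cotrans r#0 (r + s * t)
      ... | inj₂ r+st#0 = inj₁ r+st#0
      ... | inj₁ r#r+st with #⇒invertible r#r+st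
      ...   | z , z*≈1 , _ = inj₂ (#0-*ˡ (#-congʳ (trans (sym z*≈1)
                  (solve 4 (λ r s t z → z :* (r :- (r :+ s :* t)) := (con (+ 0) :- z :* t) :* s) refl r s t z)) 1#0))

  act : Letter → Basis → Basis
  act l B = basis (⟦ l ⟧ · matrix B) (·-independent l (matrix B) (independent B))

  infixr 7 _⊙_
  _⊙_ : Word → Basis → Basis
  w ⊙ B = foldr act B w

  abstract
    b₁∙b₁#0 : ∀ B → b₁ B ∙ b₁ B # 0#
    b₁∙b₁#0 (basis ((x , y) , (u , v)) indep) = pos⇒#0 ([ pos-x , pos-y ]′
      (Nonzero-cong (eq x u) (eq y v) (indep 1# 0# (inj₁ 1#0))))
      where
      eq : ∀ x u → 1# * x + 0# * u ≈ x
      eq = solve 2 (λ x u → con (+ 1) :* x :+ con (+ 0) :* u := x) refl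
      pos-x : x # 0# → 0# < x * x + y * y
      pos-x p = 0<x+y (0<x² p) (0≤x² y)
      pos-y : y # 0# → 0# < x * x + y * y
      pos-y p = <-respʳ (+-comm _ _) (0<x+y (0<x² p) (0≤x² x))

  m : Basis → Carrier
  m B = (b₂ B ∙ b₁ B) * (b₁ B ∙ b₁ B) ⁻¹⟨ b₁∙b₁#0 B ⟩

  ℓ : Basis → Carrier
  ℓ B = ∣ b₁ B ∣ * ∣ b₁ B ∣ + ∣ b₂ B ∣ * ∣ b₂ B ∣

  Proper : Basis → Set ℓ₂
  Proper B = - ½ ≤ m B × m B < ½

  Reduced : Basis → Set ℓ₂
  Reduced B = Proper B × ∣ b₁ B ∣ ≤ ∣ b₂ B ∣

  -- `B ⇝ w`: run on the input B, the Gaussian algorithm stops and records w.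
  -- Properness of T⁻ˣB determines the translation integer x.
  infix 4 _⇝_
  data _⇝_ (B : Basis) : Word → Set ℓ₂ where
    stop : ∀ x → let B′ = act (T^ (ℤ.- x)) B in
           Proper B′ → ∣ b₁ B′ ∣ ≤ ∣ b₂ B′ ∣ →
           B ⇝ T^ x ∷ []
    swap : ∀ x {w} → let B′ = act (T^ (ℤ.- x)) B in
           Proper B′ → ∣ b₂ B′ ∣ < ∣ b₁ B′ ∣ → act S B′ ⇝ w →
           B ⇝ T^ x ∷ S ∷ w

  Gaussian : Basis → Word → Set ℓ₂
  Gaussian R w = w ⊙ R ⇝ w

{-# OPTIONS --safe #-}
module Submission where

-- The length of ωR depends only on the Gram form (a , b , c) of R, on which
-- ST^x acts by (a , b , c) ↦ (c + 2xb + x²a , b + xa , a).  Properness and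
-- descent force |x_i| ≥ 2 for i ≥ 2, and forbid |x_i| = 2 when b and x_i have
-- opposite signs, except that the first swap may leave such a b.  Up to the
-- sign of b, every step therefore yields a form entrywise at least the one
-- that x = 2 yields, and this step is monotone in the entries a, b and c; so
-- the form stays above the one of the extremal word, provided that it does
-- so after the first step.  The final translation starts from a proper basis
-- and hence cannot shorten it.

open import Algebra.Solver.Ring.AlmostCommutativeRing using (_-Raw-AlmostCommutative⟶_)
open import Data.Empty using (⊥-elim)
open import Data.Integer as ℤ using (ℤ; +_; -[1+_])
open import Data.List using ([]; _∷_; _++_; foldr)
open import Data.Nat using (ℕ; zero; suc; _∸_; NonZero)
open import Data.Product using (_×_; _,_; proj₁; proj₂)
open import Data.Sum as Sum using (_⊎_; inj₁; inj₂; [_,_]′)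
open import Function.Bundles using (module Equivalence)
open import Level using (_⊔_)
open import Defs

-- Order lemmas for `≤` as a negated `<`, and the integers inside the field.

module OrderProperties {c ℓ₁ ℓ₂} (ℝ : RealField c ℓ₁ ℓ₂) where

  open RealField ℝ hiding (zero)
  open RealFieldProperties ℝ
  open Solver using (solve; _:=_; _:+_; _:*_; _:-_; con)

  abstract
    ≤-refl : ∀ {x} → x ≤ x
    ≤-refl = <-irrefl refl

    -- Since `≤` is the negation of `<`, its transitivity is the cotransitivity of `<`.
    ≤-trans : ∀ {x y z} → x ≤ y → y ≤ z → x ≤ z
    ≤-trans {y = y} x≤y y≤z z<x = [ y≤z , x≤y ]′ (<-cotrans z<x y)

    ≤-respʳ : ∀ {x y z} → y ≈ z → x ≤ y → x ≤ z
    ≤-respʳ y≈z x≤y z<x = x≤y (<-respˡ (sym y≈z) z<x)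

    ≤-respˡ : ∀ {x y z} → x ≈ y → x ≤ z → y ≤ z
    ≤-respˡ x≈y x≤z z<y = x≤z (<-respʳ (sym x≈y) z<y)

    0≤-⇒≤ : ∀ {x y} → 0# ≤ y - x → x ≤ y
    0≤-⇒≤ {x} {y} p y<x = p (0<-⇒< (<-respʳ
      (solve 2 (λ x y → x :- y := con (+ 0) :- (y :- x)) refl x y) (<⇒0<- y<x)))

    ≤⇒0≤- : ∀ {x y} → x ≤ y → 0# ≤ y - x
    ≤⇒0≤- {x} {y} p q = p (0<-⇒< (<-respʳ
      (solve 2 (λ x y → con (+ 0) :- (y :- x) := x :- y) refl x y) (<⇒0<- q)))

    ≤-<-trans : ∀ {x y z} → x ≤ y → y < z → x < z
    ≤-<-trans {x} x≤y y<z = [ (λ y<x → ⊥-elim (x≤y y<x)) , (λ x<z → x<z) ]′ (<-cotrans y<z x)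

    +-mono-≤ : ∀ {x y u v} → x ≤ y → u ≤ v → x + u ≤ y + v
    +-mono-≤ {x} {y} {u} {v} x≤y u≤v = 0≤-⇒≤ (≤-respʳ
      (solve 4 (λ x y u v → (y :- x) :+ (v :- u) := (y :+ v) :- (x :+ u)) refl x y u v)
      (0≤x+y (≤⇒0≤- x≤y) (≤⇒0≤- u≤v)))

    0≤x+x⇒0≤x : ∀ {x} → 0# ≤ x + x → 0# ≤ x
    0≤x+x⇒0≤x {x} 0≤x+x x<0 = 0≤x+x (0<-⇒< (<-respʳ
      (solve 1 (λ x → (con (+ 0) :- x) :+ (con (+ 0) :- x) := con (+ 0) :- (x :+ x)) refl x)
      (0<x+y (<⇒0<- x<0) (<⇒≤ (<⇒0<- x<0)))))

    0≤#0⇒0< : ∀ {x} → 0# ≤ x → x # 0# → 0# < x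
    0≤#0⇒0< {x} 0≤x x#0 = [ (λ x<0 → ⊥-elim (0≤x x<0)) , (λ 0<x → 0<x) ]′ (Equivalence.to #⇔<⊎> x#0)

    -- Signs of factors cannot be decided outright. But a negative product is apart from zero, so
    -- both factors are apart from zero, hence positive, and the product is positive after all.
    *-nonneg : ∀ {x y} → 0# ≤ x → 0# ≤ y → 0# ≤ x * y
    *-nonneg {x} {y} 0≤x 0≤y xy<0 = <⇒≤
      (*-pos (0≤#0⇒0< 0≤x (#0-*ˡ (#-congʳ (*-comm x y) (<⇒# xy<0)))) (0≤#0⇒0< 0≤y (#0-*ˡ (<⇒# xy<0))))
      xy<0

    square-mono-< : ∀ {x y} → 0# ≤ x → x < y → x * x < y * y
    square-mono-< {x} {y} 0≤x x<y = 0<-⇒< (<-respʳ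
      (solve 2 (λ x y → (y :+ x) :* (y :- x) := y :* y :- x :* x) refl x y)
      (*-pos (0<x+y (≤-<-trans 0≤x x<y) 0≤x) (<⇒0<- x<y)))

    fromℤ-+ : ∀ i j → fromℤ (i ℤ.+ j) ≈ fromℤ i + fromℤ j
    fromℤ-+ = _-Raw-AlmostCommutative⟶_.+-homo fromℤ-morphism

    fromℤ-neg : ∀ i → fromℤ (ℤ.- i) ≈ - fromℤ i
    fromℤ-neg = _-Raw-AlmostCommutative⟶_.-‿homo fromℤ-morphism

    0≤fromℕ : ∀ n → 0# ≤ fromℕ n
    0≤fromℕ zero    = ≤-refl
    0≤fromℕ (suc n) = ≤-respʳ (sym (fromℤ-+ (+ 1) (+ n))) (0≤x+y (<⇒≤ 0<1) (0≤fromℕ n))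

-- Gram forms and the action of words on them.

module Forms {ℓ ℓ₁ ℓ₂} (ℝ : RealField ℓ ℓ₁ ℓ₂) where

  open RealField ℝ hiding (zero)
  open RealFieldProperties ℝ
  open OrderProperties ℝ
  open Solver using (solve; _:=_; _:+_; _:*_; _:-_; :-_; con)

  -- (a , b , c) stands for the Gram matrix ((a , b) , (b , c)) of a basis.
  record Form : Set ℓ where
    constructor form
    field
      a b c : Carrier

  open Form

  infix 4 _≋_
  record _≋_ (F G : Form) : Set ℓ₁ where
    constructor mk≋
    field
      a≈ : a F ≈ a G
      b≈ : b F ≈ b G
      c≈ : c F ≈ c G

  ≋-refl : ∀ {F} → F ≋ F
  ≋-refl = mk≋ refl refl refl

  ≋-sym : ∀ {F G} → F ≋ G → G ≋ F
  ≋-sym (mk≋ p q r) = mk≋ (sym p) (sym q) (sym r)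

  ≋-trans : ∀ {F G H} → F ≋ G → G ≋ H → F ≋ H
  ≋-trans (mk≋ p q r) (mk≋ p′ q′ r′) = mk≋ (trans p p′) (trans q q′) (trans r r′)

  exchange : Form → Form
  exchange (form a b c) = form c b a

  translate : Carrier → Form → Form
  translate t (form a b c) = form a (b + t * a) (c + (t * b + t * b) + t * t * a)

  -- The effect of replacing one basis vector by its negative; it leaves both squared norms
  -- unchanged.
  flip : Form → Form
  flip (form a b c) = form a (- b) c

  -- The action of the block `ST^ x` on Gram forms, for `t = fromℤ x`.
  next : Carrier → Form → Form
  next t F = exchange (translate t F)

  size : Form → Carrier
  size F = a F + c F

  exchange-cong : ∀ {F G} → F ≋ G → exchange F ≋ exchange G
  exchange-cong (mk≋ p q r) = mk≋ r q p

  translate-cong : ∀ {s t F G} → s ≈ t → F ≋ G → translate s F ≋ translate t G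
  translate-cong s≈t (mk≋ p q r) = mk≋ p (+-cong q (*-cong s≈t p))
    (+-cong (+-cong r (+-cong (*-cong s≈t q) (*-cong s≈t q))) (*-cong (*-cong s≈t s≈t) p))

  next-cong : ∀ {s t F G} → s ≈ t → F ≋ G → next s F ≋ next t G
  next-cong s≈t F≋G = exchange-cong (translate-cong s≈t F≋G)

  flip-cong : ∀ {F G} → F ≋ G → flip F ≋ flip G
  flip-cong (mk≋ p q r) = mk≋ p (-‿cong q) r

  size-cong : ∀ {F G} → F ≋ G → size F ≈ size G
  size-cong (mk≋ p q r) = +-cong p r

  abstract
    translate-inverse : ∀ {s t} F → s ≈ - t → translate s (translate t F) ≋ F
    translate-inverse {s} {t} F@(form a b c) s≈-t =
      ≋-trans (translate-cong s≈-t (≋-refl {translate t F})) (mk≋ refl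
        (solve 3 (λ t a b → b :+ t :* a :+ (:- t) :* a := b) refl t a b)
        (solve 4 (λ t a b c → let s = :- t ; b′ = b :+ t :* a in
          (c :+ (t :* b :+ t :* b) :+ t :* t :* a) :+ (s :* b′ :+ s :* b′) :+ s :* s :* a := c) refl t a b c))

    -- The mirror symmetry of the problem: negating the translation integer together with `b`
    -- changes only the sign of the new middle entry. It halves the case analysis on signs and
    -- relates `ST^` of -2 to `grow`.
    next-flip : ∀ {s t} F → s ≈ - t → next s (flip F) ≋ flip (next t F)
    next-flip {s} {t} F@(form a b c) s≈-t =
      ≋-trans (next-cong s≈-t (≋-refl {flip F})) (mk≋
        (solve 4 (λ t a b c → c :+ ((:- t) :* (:- b) :+ (:- t) :* (:- b)) :+ (:- t) :* (:- t) :* a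
          := c :+ (t :* b :+ t :* b) :+ t :* t :* a) refl t a b c)
        (solve 3 (λ t a b → (:- b) :+ (:- t) :* a := :- (b :+ t :* a)) refl t a b)
        refl)

    flip-involutive : ∀ F → flip (flip F) ≋ F
    flip-involutive (form a b c) = mk≋ refl (solve 1 (λ b → :- (:- b) := b) refl b) refl

  -- This is the closure of properness, `2|b| ≤ a`. Unlike `ProperForm`, whose upper bound is
  -- strict, it is stable under `flip`.
  record Balanced (F : Form) : Set ℓ₂ where
    constructor balanced
    field
      0<a    : 0# < a F
      0≤a+2b : 0# ≤ a F + (b F + b F)
      0≤a-2b : 0# ≤ a F - (b F + b F)

  -- The condition -1/2 ≤ b/a < 1/2, cleared of denominators.
  record ProperForm (F : Form) : Set ℓ₂ where
    constructor properForm
    field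
      0<a    : 0# < a F
      0≤a+2b : 0# ≤ a F + (b F + b F)
      0<a-2b : 0# < a F - (b F + b F)

  proper⇒balanced : ∀ {F} → ProperForm F → Balanced F
  proper⇒balanced (properForm p q r) = balanced p q (<⇒≤ r)

  proper-resp : ∀ {F G} → F ≋ G → ProperForm F → ProperForm G
  proper-resp (mk≋ p q _) (properForm u v w) = properForm (<-respʳ p u)
    (≤-respʳ (+-cong p (+-cong q q)) v) (<-respʳ (+-cong p (-‿cong (+-cong q q))) w)

  balanced-resp : ∀ {F G} → F ≋ G → Balanced F → Balanced G
  balanced-resp (mk≋ p q _) (balanced u v w) = balanced (<-respʳ p u)
    (≤-respʳ (+-cong p (+-cong q q)) v) (≤-respʳ (+-cong p (-‿cong (+-cong q q))) w)

  balanced-flip : ∀ {F} → Balanced F → Balanced (flip F)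
  balanced-flip {form a b c} (balanced u v w) = balanced u
    (≤-respʳ (solve 2 (λ a b → a :- (b :+ b) := a :+ (:- b :+ :- b)) refl a b) w)
    (≤-respʳ (solve 2 (λ a b → a :+ (b :+ b) := a :- (:- b :+ :- b)) refl a b) v)

  Descending : Form → Set ℓ₂
  Descending F = c F < a F

  descending-resp : ∀ {F G} → F ≋ G → Descending F → Descending G
  descending-resp (mk≋ p _ r) d = <-respˡ r (<-respʳ p d)

  -- Entrywise comparison with the extremal growth.

  grow : Form → Form
  grow = next (fromℤ (+ 2))

  -- Translation by -2 is the only admissible one that could make F grow less
  -- than `grow` does: it is harmless if b ≤ 0 and improper if c < 2b.
  record Dominates (F G : Form) : Set (ℓ₁ ⊔ ℓ₂) where
    constructor dominates
    field
      a≥ : a G ≤ a F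
      b≥ : b G ≤ b F
      c≥ : c G ≤ c F
      unaligned : b F ≤ 0# ⊎ c F < b F + b F

  dominates-respˡ : ∀ {F F′ G} → F ≋ F′ → Dominates F G → Dominates F′ G
  dominates-respˡ (mk≋ p q r) (dominates u v w z) = dominates
    (≤-respʳ p u) (≤-respʳ q v) (≤-respʳ r w)
    (Sum.map (≤-respˡ q) (λ h → <-respˡ r (<-respʳ (+-cong q q) h)) z)

  -- The sign of `b` may change from step to step along a run, whereas `G` is grown by translation
  -- by 2 only; hence the comparison is made up to `flip`.
  Tracks : Form → Form → Set (ℓ₁ ⊔ ℓ₂)
  Tracks F G = Dominates F G ⊎ Dominates (flip F) G

  tracks-flip : ∀ {F F′ G} → F ≋ flip F′ → Tracks F G → Tracks F′ G
  tracks-flip e (inj₁ d) = inj₂ (dominates-respˡ e d)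
  tracks-flip e (inj₂ d) = inj₁ (dominates-respˡ (≋-trans (flip-cong e) (flip-involutive _)) d)

  tracks-size : ∀ {F G} → Tracks F G → size G ≤ size F
  tracks-size (inj₁ d) = +-mono-≤ (Dominates.a≥ d) (Dominates.c≥ d)
  tracks-size (inj₂ d) = +-mono-≤ (Dominates.a≥ d) (Dominates.c≥ d)

  abstract
    -- The entries of `grow F` are combinations of those of `F` with nonnegative coefficients. The
    -- third one is `a F` itself.
    grow-mono : ∀ {F G} → a G ≤ a F → b G ≤ b F → c G ≤ c F →
                a (grow G) ≤ a (grow F) × b (grow G) ≤ b (grow F)
    grow-mono {form a b c} {form A B C} p q r =
      0≤-⇒≤ (≤-respʳ
        (solve 6 (λ a b c A B C → (c :- C) :+ (((b :- B) :+ (b :- B) :+ ((b :- B) :+ (b :- B))) :+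
            (((a :- A) :+ (a :- A)) :+ ((a :- A) :+ (a :- A))))
          := (c :+ (con (+ 2) :* b :+ con (+ 2) :* b) :+ con (+ 2) :* con (+ 2) :* a)
            :- (C :+ (con (+ 2) :* B :+ con (+ 2) :* B) :+ con (+ 2) :* con (+ 2) :* A))
          refl a b c A B C)
        (0≤x+y r′ (0≤x+y (0≤x+y (0≤x+y q′ q′) (0≤x+y q′ q′)) (0≤x+y (0≤x+y p′ p′) (0≤x+y p′ p′))))) ,
      0≤-⇒≤ (≤-respʳ
        (solve 4 (λ a b A B → (b :- B) :+ ((a :- A) :+ (a :- A))
          := (b :+ con (+ 2) :* a) :- (B :+ con (+ 2) :* A)) refl a b A B)
        (0≤x+y q′ (0≤x+y p′ p′)))
      where
      p′ : 0# ≤ a - A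
      p′ = ≤⇒0≤- p
      q′ : 0# ≤ b - B
      q′ = ≤⇒0≤- q
      r′ : 0# ≤ c - C
      r′ = ≤⇒0≤- r

    -- Translating by `2 + r` instead of 2 adds `r (a + 2b) + 3ra + r²a` to the first entry and `ra`
    -- to the second. The new `2b` exceeds the new `c`, which is the old `a`, so the result is again
    -- unaligned.
    next-aligned : ∀ {F G} r → 0# ≤ r → Balanced F → Dominates F G →
                   Dominates (next (fromℤ (+ 2) + r) F) (grow G)
    next-aligned {form a b c} {G} r 0≤r (balanced 0<a 0≤a+2b _) (dominates p q s _) = dominates
      (≤-trans (proj₁ mono) (0≤-⇒≤ (≤-respʳ
        (solve 4 (λ a b c r → let t = con (+ 2) :+ r in
            r :* (a :+ (b :+ b)) :+ (r :* a :+ r :* a :+ (r :* a :+ r :* (r :* a)))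
          := (c :+ (t :* b :+ t :* b) :+ t :* t :* a)
            :- (c :+ (con (+ 2) :* b :+ con (+ 2) :* b) :+ con (+ 2) :* con (+ 2) :* a)) refl a b c r)
        (0≤x+y (*-nonneg 0≤r 0≤a+2b) (0≤x+y (0≤x+y 0≤ra 0≤ra) (0≤x+y 0≤ra (*-nonneg 0≤r 0≤ra)))))))
      (≤-trans (proj₂ mono) (0≤-⇒≤ (≤-respʳ
        (solve 3 (λ a b r → r :* a := (b :+ (con (+ 2) :+ r) :* a) :- (b :+ con (+ 2) :* a)) refl a b r)
        0≤ra)))
      p
      (inj₂ (0<-⇒< (<-respʳ
        (solve 3 (λ a b r → let b′ = b :+ (con (+ 2) :+ r) :* a in
          a :+ (a :+ (b :+ b) :+ (a :+ (r :* a :+ r :* a))) := (b′ :+ b′) :- a) refl a b r)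
        (0<x+y 0<a (0≤x+y 0≤a+2b (0≤x+y (<⇒≤ 0<a) (0≤x+y 0≤ra 0≤ra)))))))
      where
      mono : Form.a (grow G) ≤ Form.a (grow (form a b c)) × Form.b (grow G) ≤ Form.b (grow (form a b c))
      mono = grow-mono {form a b c} {G} p q s
      0≤ra : 0# ≤ r * a
      0≤ra = *-nonneg 0≤r (<⇒≤ 0<a)

    -- With `w = r a - 2b`, the flipped result exceeds `grow F` by `(4 + r) w` in the first entry
    -- and by `w` in the second, so the single condition `0 ≤ w` controls both.
    next-opposed : ∀ {F G} r → 0# ≤ r → Balanced F → 0# ≤ r * a F - (b F + b F) → Dominates F G →
                   Dominates (flip (next (- (fromℤ (+ 2) + r)) F)) (grow G)
    next-opposed {form a b c} {G} r 0≤r (balanced 0<a _ 0≤a-2b) 0≤w (dominates p q s _) = dominates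
      (≤-trans (proj₁ mono) (0≤-⇒≤ (≤-respʳ
        (solve 4 (λ a b c r → let t = :- (con (+ 2) :+ r) ; w = r :* a :- (b :+ b) in
            w :+ w :+ (w :+ w) :+ r :* w
          := (c :+ (t :* b :+ t :* b) :+ t :* t :* a)
            :- (c :+ (con (+ 2) :* b :+ con (+ 2) :* b) :+ con (+ 2) :* con (+ 2) :* a)) refl a b c r)
        (0≤x+y (0≤x+y (0≤x+y 0≤w 0≤w) (0≤x+y 0≤w 0≤w)) (*-nonneg 0≤r 0≤w)))))
      (≤-trans (proj₂ mono) (0≤-⇒≤ (≤-respʳ
        (solve 3 (λ a b r → r :* a :- (b :+ b)
          := :- (b :+ (:- (con (+ 2) :+ r)) :* a) :- (b :+ con (+ 2) :* a)) refl a b r)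
        0≤w)))
      p
      (inj₂ (0<-⇒< (<-respʳ
        (solve 3 (λ a b r → let b′ = :- (b :+ (:- (con (+ 2) :+ r)) :* a) in
          a :+ (a :- (b :+ b) :+ (a :+ (r :* a :+ r :* a))) := (b′ :+ b′) :- a) refl a b r)
        (0<x+y 0<a (0≤x+y 0≤a-2b (0≤x+y (<⇒≤ 0<a) (0≤x+y 0≤ra 0≤ra)))))))
      where
      mono : Form.a (grow G) ≤ Form.a (grow (form a b c)) × Form.b (grow G) ≤ Form.b (grow (form a b c))
      mono = grow-mono {form a b c} {G} p q s
      0≤ra : 0# ≤ r * a
      0≤ra = *-nonneg 0≤r (<⇒≤ 0<a)

    -- Properness before and after the translation forces |y| ≥ 2, and y ≠ -2 unless b F ≤ 0.
    next-tracks-dominates : ∀ {F G} y → Balanced F → Descending F →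
      Balanced (next (fromℤ y) F) → Descending (next (fromℤ y) F) →
      Dominates F G → Tracks (next (fromℤ y) F) (grow G)
    next-tracks-dominates {form a b c} (+ 0) _ c<a _ a<a′ _ = ⊥-elim (<⇒≤ c<a (<-respʳ
      (solve 3 (λ a b c → c :+ (con (+ 0) :* b :+ con (+ 0) :* b) :+ con (+ 0) :* con (+ 0) :* a := c)
        refl a b c) a<a′))
    -- For t = 1 the new `a - 2b` is the old `c - a`, negative by descent; for t = -1 the same
    -- happens to the new `a + 2b`.
    next-tracks-dominates {form a b c} (+ 1) _ c<a (balanced _ _ 0≤a′-2b′) _ _ = ⊥-elim (0≤-⇒≤
      (≤-respʳ (solve 3 (λ a b c → let t = con (+ 1) ; b′ = b :+ t :* a in
        (c :+ (t :* b :+ t :* b) :+ t :* t :* a) :- (b′ :+ b′) := c :- a) refl a b c) 0≤a′-2b′) c<a)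
    next-tracks-dominates {form a b c} -[1+ 0 ] _ c<a (balanced _ 0≤a′+2b′ _) _ _ = ⊥-elim (0≤-⇒≤
      (≤-respʳ (solve 3 (λ a b c → let t = con -[1+ 0 ] ; b′ = b :+ t :* a in
        (c :+ (t :* b :+ t :* b) :+ t :* t :* a) :+ (b′ :+ b′) := c :- a) refl a b c) 0≤a′+2b′) c<a)
    next-tracks-dominates {F} (+ suc (suc n)) bal _ _ _ dom = inj₁ (dominates-respˡ
      (next-cong (sym (fromℤ-+ (+ 2) (+ n))) (≋-refl {F})) (next-aligned (fromℕ n) (0≤fromℕ n) bal dom))
    -- For t = -2 the new `a + 2b` is the old `c - 2b`, so balance of the new form refutes `c < 2b`.
    -- The remaining alternative `b ≤ 0` is the condition of `next-opposed` at r = 0.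
    next-tracks-dominates {F@(form a b c)} -[1+ 1 ] bal _ (balanced _ 0≤a′+2b′ _) _ dom =
      inj₂ (dominates-respˡ
        (flip-cong (next-cong (solve 0 (:- (con (+ 2) :+ con (+ 0)) := con -[1+ 1 ]) refl) (≋-refl {F})))
        (next-opposed 0# ≤-refl bal ([ (λ b≤0 → ≤-respʳ
            (solve 2 (λ a b → (con (+ 0) :- b) :+ (con (+ 0) :- b) := con (+ 0) :* a :- (b :+ b)) refl a b)
            (0≤x+y (≤⇒0≤- b≤0) (≤⇒0≤- b≤0)))
          , (λ c<2b → ⊥-elim (0≤-⇒≤ (≤-respʳ
            (solve 3 (λ a b c → let t = con -[1+ 1 ] ; b′ = b :+ t :* a in
              (c :+ (t :* b :+ t :* b) :+ t :* t :* a) :+ (b′ :+ b′) := c :- (b :+ b)) refl a b c)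
            0≤a′+2b′) c<2b)) ]′ (Dominates.unaligned dom)) dom))
    -- Here y = -(2 + r) with r = 1 + n, and the condition splits as `(a - 2b) + n a`, which balance
    -- makes nonnegative.
    next-tracks-dominates {F@(form a b c)} -[1+ suc (suc n) ] bal@(balanced 0<a _ 0≤a-2b) _ _ _ dom =
      inj₂ (dominates-respˡ
        (flip-cong (next-cong (-‿cong (trans (+-congˡ r≈) (sym (fromℤ-+ (+ 2) (+ suc n))))) (≋-refl {F})))
        (next-opposed (1# + fromℕ n) (0≤x+y (<⇒≤ 0<1) (0≤fromℕ n)) bal (≤-respʳ
          (solve 3 (λ a b r → (a :- (b :+ b)) :+ r :* a := (con (+ 1) :+ r) :* a :- (b :+ b)) refl a b (fromℕ n))
          (0≤x+y 0≤a-2b (*-nonneg (0≤fromℕ n) (<⇒≤ 0<a)))) dom))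
      where
      r≈ : 1# + fromℕ n ≈ fromℕ (suc n)
      r≈ = sym (fromℤ-+ (+ 1) (+ n))

    -- If it is `flip F` that dominates, the previous lemma is applied to `flip F` with the integer
    -- `- y`, and `next-flip` carries the result back.
    next-tracks : ∀ {F G} y → Balanced F → Descending F →
      Balanced (next (fromℤ y) F) → Descending (next (fromℤ y) F) →
      Tracks F G → Tracks (next (fromℤ y) F) (grow G)
    next-tracks y bal d bal′ d′ (inj₁ dom) = next-tracks-dominates y bal d bal′ d′ dom
    next-tracks {F} y bal d bal′ d′ (inj₂ dom) = tracks-flip e
      (next-tracks-dominates (ℤ.- y) (balanced-flip bal) d
        (balanced-resp (≋-sym e) (balanced-flip bal′)) (descending-resp (≋-sym e) d′) dom)
      where
      e : next (fromℤ (ℤ.- y)) (flip F) ≋ flip (next (fromℤ y) F)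
      e = next-flip F (fromℤ-neg y)

    -- The increment of c F under translation by y.
    translate-increment-nonneg : ∀ {F} y → Balanced F → let t = fromℤ y in
      0# ≤ (t * b F + t * b F) + t * t * a F
    translate-increment-nonneg {form a b c} (+ 0) _ = ≤-respʳ
      (solve 2 (λ a b → con (+ 0) := (con (+ 0) :* b :+ con (+ 0) :* b) :+ con (+ 0) :* con (+ 0) :* a)
        refl a b) ≤-refl
    -- For t = 1 + n the increment is `t (a + 2b) + t (t - 1) a`.
    translate-increment-nonneg {F@(form a b c)} (+ suc n) (balanced 0<a 0≤a+2b _) = ≤-respʳ
      (trans (solve 3 (λ a b r → let t = con (+ 1) :+ r in
          a :+ (b :+ b) :+ r :* (a :+ (b :+ b)) :+ (r :* a :+ r :* (r :* a))
          := (t :* b :+ t :* b) :+ t :* t :* a) refl a b (fromℕ n))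
        (increment-cong (sym (fromℤ-+ (+ 1) (+ n)))))
      (0≤x+y (0≤x+y 0≤a+2b (*-nonneg 0≤r 0≤a+2b)) (0≤x+y 0≤ra (*-nonneg 0≤r 0≤ra)))
      where
      r : Carrier
      r = fromℕ n
      0≤r : 0# ≤ r
      0≤r = 0≤fromℕ n
      0≤ra : 0# ≤ r * a
      0≤ra = *-nonneg 0≤r (<⇒≤ 0<a)
      increment-cong : ∀ {s t} → s ≈ t → (s * b + s * b) + s * s * a ≈ (t * b + t * b) + t * t * a
      increment-cong e = +-cong (+-cong (*-congʳ e) (*-congʳ e)) (*-congʳ (*-cong e e))
    translate-increment-nonneg {form a b c} -[1+ n ] bal = ≤-respʳ
      (solve 3 (λ t a b → (t :* (:- b) :+ t :* (:- b)) :+ t :* t :* a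
        := ((:- t) :* b :+ (:- t) :* b) :+ (:- t) :* (:- t) :* a) refl (fromℤ (+ suc n)) a b)
      (translate-increment-nonneg {flip (form a b c)} (+ suc n) (balanced-flip bal))

    size≤translate : ∀ {F} y → Balanced F → size F ≤ size (translate (fromℤ y) F)
    size≤translate {form a b c} y bal = 0≤-⇒≤ (≤-respʳ
      (solve 4 (λ a c u v → u :+ v := (a :+ (c :+ u :+ v)) :- (a :+ c)) refl a c
        (fromℤ y * b + fromℤ y * b) (fromℤ y * fromℤ y * a))
      (translate-increment-nonneg {form a b c} y bal))

    c≤next : ∀ {F} y → Balanced F → c F ≤ a (next (fromℤ y) F)
    c≤next {form a b c} y bal = 0≤-⇒≤ (≤-respʳ
      (solve 3 (λ c u v → u :+ v := (c :+ u :+ v) :- c) refl c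
        (fromℤ y * b + fromℤ y * b) (fromℤ y * fromℤ y * a))
      (translate-increment-nonneg {form a b c} y bal))

    -- The hypotheses on `β` say that it is `-|b|`, so the seed is the swapped form with its middle
    -- entry made as small as its sign allows. The last hypothesis decides whether m exceeds -1/2,
    -- on which the choice of sign depends when y = 1.
    first-tracks : ∀ {F β} y → ProperForm F →
      β ≤ b F → β ≤ - b F → β ≈ b F ⊎ β ≈ - b F →
      0# < a F + (b F + b F) ⊎ a F + (b F + b F) ≈ 0# →
      Tracks (next (fromℤ y) F) (form (c F) β (a F))
    first-tracks {F@(form a b c)} {β} (+ 0) prop β≤b β≤-b β≈±b _ =
      [ (λ β≈b → inj₁ (dominates (c≤next {F} (+ 0) (proper⇒balanced prop)) (≤-respʳ b≈ β≤b) ≤-refl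
          (inj₁ (≤-respˡ b≈ (0≤-⇒≤ (0≤x+x⇒0≤x (≤-respʳ
            (solve 1 (λ b → :- b :- b := (con (+ 0) :- b) :+ (con (+ 0) :- b)) refl b)
            (≤⇒0≤- (≤-respˡ β≈b β≤-b)))))))))
      , (λ β≈-b → inj₂ (dominates (c≤next {F} (+ 0) (proper⇒balanced prop)) (≤-respʳ (-‿cong b≈) β≤-b) ≤-refl
          (inj₁ (≤-respˡ (-‿cong b≈) (0≤-⇒≤ (0≤x+x⇒0≤x (≤-respʳ
            (solve 1 (λ b → b :- (:- b) := (con (+ 0) :- (:- b)) :+ (con (+ 0) :- (:- b))) refl b)
            (≤⇒0≤- (≤-respˡ β≈-b β≤b)))))))))
      ]′ β≈±b
      where
      b≈ : b ≈ b + fromℤ (+ 0) * a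
      b≈ = solve 2 (λ a b → b := b :+ con (+ 0) :* a) refl a b
    first-tracks {F@(form a b c)} {β} (+ 1) prop@(properForm 0<a 0≤a+2b _) β≤b _ _ =
      [ (λ 0<a+2b → inj₁ (dominates c≤ (≤-trans β≤b (0≤-⇒≤ (≤-respʳ
            (solve 2 (λ a b → a := (b :+ con (+ 1) :* a) :- b) refl a b) (<⇒≤ 0<a)))) ≤-refl
          (inj₂ (0<-⇒< (<-respʳ
            (solve 2 (λ a b → let b′ = b :+ con (+ 1) :* a in a :+ (b :+ b) := (b′ :+ b′) :- a) refl a b)
            0<a+2b)))))
      -- At m = -1/2 the new middle entry is `a/2`, so `c < 2b` just fails for the new form; its
      -- flip has a nonpositive middle entry and is used instead.
      , (λ a+2b≈0 → inj₂ (dominates c≤ (≤-respʳ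
            (trans (solve 2 (λ a b → b := :- (b :+ con (+ 1) :* a) :+ (a :+ (b :+ b))) refl a b)
              (trans (+-congˡ a+2b≈0) (+-identityʳ _))) β≤b) ≤-refl
          (inj₁ (0≤-⇒≤ (0≤x+x⇒0≤x (≤-respʳ
            (solve 2 (λ a b → let b′ = con (+ 0) :- :- (b :+ con (+ 1) :* a) in
              (a :+ (b :+ b)) :+ a := b′ :+ b′) refl a b)
            (0≤x+y 0≤a+2b (<⇒≤ 0<a))))))))
      ]′
      where
      c≤ : c ≤ Form.a (next (fromℤ (+ 1)) F)
      c≤ = c≤next {F} (+ 1) (proper⇒balanced prop)
    first-tracks {F@(form a b c)} {β} y@(+ suc (suc n)) prop@(properForm 0<a 0≤a+2b _) β≤b _ _ _ =
      inj₁ (dominates (c≤next {F} y (proper⇒balanced prop))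
        (≤-trans β≤b (0≤-⇒≤ (≤-respʳ
          (trans (solve 3 (λ a b r → a :+ (a :+ r :* a) := (b :+ (con (+ 2) :+ r) :* a) :- b) refl a b r)
            (+-congʳ b′≈))
          (0≤x+y (<⇒≤ 0<a) (0≤x+y (<⇒≤ 0<a) 0≤ra)))))
        ≤-refl
        (inj₂ (0<-⇒< (<-respʳ
          (trans (solve 3 (λ a b r → let b′ = b :+ (con (+ 2) :+ r) :* a in
              a :+ (a :+ (b :+ b) :+ (a :+ (r :* a :+ r :* a))) := (b′ :+ b′) :- a) refl a b r)
            (+-congʳ (+-cong b′≈ b′≈)))
          (0<x+y 0<a (0≤x+y 0≤a+2b (0≤x+y (<⇒≤ 0<a) (0≤x+y 0≤ra 0≤ra))))))))
      where
      r : Carrier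
      r = fromℕ n
      0≤ra : 0# ≤ r * a
      0≤ra = *-nonneg (0≤fromℕ n) (<⇒≤ 0<a)
      b′≈ : b + (fromℤ (+ 2) + r) * a ≈ b + fromℤ y * a
      b′≈ = +-congˡ (*-congʳ (sym (fromℤ-+ (+ 2) (+ n))))
    -- The strict bound `0 < a - 2b` puts the flipped new form in the second alternative of
    -- `unaligned` already at y = -1.
    first-tracks {F@(form a b c)} {β} y@(-[1+ n ]) prop@(properForm 0<a _ 0<a-2b) _ β≤-b _ _ =
      inj₂ (dominates (c≤next {F} y (proper⇒balanced prop))
        (≤-trans β≤-b (0≤-⇒≤ (≤-respʳ
          (trans (solve 3 (λ a b r → a :+ r :* a := (:- (b :+ (:- (con (+ 1) :+ r)) :* a)) :- (:- b)) refl a b r)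
            (+-congʳ b′≈))
          (0≤x+y (<⇒≤ 0<a) 0≤ra))))
        ≤-refl
        (inj₂ (0<-⇒< (<-respʳ
          (trans (solve 3 (λ a b r → let b′ = :- (b :+ (:- (con (+ 1) :+ r)) :* a) in
              a :- (b :+ b) :+ (r :* a :+ r :* a) := (b′ :+ b′) :- a) refl a b r)
            (+-congʳ (+-cong b′≈ b′≈)))
          (0<x+y 0<a-2b (0≤x+y 0≤ra 0≤ra))))))
      where
      r : Carrier
      r = fromℕ n
      0≤ra : 0# ≤ r * a
      0≤ra = *-nonneg (0≤fromℕ n) (<⇒≤ 0<a)
      b′≈ : - (b + (- (fromℤ (+ 1) + r)) * a) ≈ - (b + fromℤ y * a)
      b′≈ = -‿cong (+-congˡ (*-congʳ (-‿cong (sym (fromℤ-+ (+ 1) (+ n))))))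

    -- For a F ≈ c F, properness and descent exclude translation by 0 and 1.
    first-tracks-equal : ∀ {F} y → ProperForm F → a F ≈ c F →
      ProperForm (next (fromℤ y) F) → Descending (next (fromℤ y) F) →
      Tracks (next (fromℤ y) F) (flip (next (fromℤ -[1+ 0 ]) F))
    first-tracks-equal {form a b c} (+ 0) _ a≈c _ d = ⊥-elim (<-irrefl a≈c (<-respʳ
      (solve 3 (λ a b c → c :+ (con (+ 0) :* b :+ con (+ 0) :* b) :+ con (+ 0) :* con (+ 0) :* a := c)
        refl a b c) d))
    first-tracks-equal {form a b c} (+ 1) _ a≈c (properForm _ _ 0<a′-2b′) _ = ⊥-elim (<-irrefl a≈c (0<-⇒<
      (<-respʳ (solve 3 (λ a b c → let t = con (+ 1) ; b′ = b :+ t :* a in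
        (c :+ (t :* b :+ t :* b) :+ t :* t :* a) :- (b′ :+ b′) := c :- a) refl a b c) 0<a′-2b′)))
    -- With `w = a + 2b + ra`, the excess over the seed is `(3 + r) w` in the first entry and `w` in
    -- the second.
    first-tracks-equal {F@(form a b c)} y@(+ suc (suc n)) (properForm 0<a 0≤a+2b _) _ _ _ =
      inj₁ (dominates-respˡ (next-cong (sym (fromℤ-+ (+ 2) (+ n))) (≋-refl {F})) (dominates
        (0≤-⇒≤ (≤-respʳ
          (solve 4 (λ a b c r → let t = con (+ 2) :+ r ; s = con -[1+ 0 ] ; w = (a :+ (b :+ b)) :+ r :* a in
            w :+ (w :+ w) :+ r :* w
            := (c :+ (t :* b :+ t :* b) :+ t :* t :* a) :- (c :+ (s :* b :+ s :* b) :+ s :* s :* a)) refl a b c r)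
          (0≤x+y (0≤x+y 0≤w (0≤x+y 0≤w 0≤w)) (*-nonneg 0≤r 0≤w))))
        (0≤-⇒≤ (≤-respʳ
          (solve 3 (λ a b r → (a :+ (b :+ b)) :+ r :* a
            := (b :+ (con (+ 2) :+ r) :* a) :- (:- (b :+ con -[1+ 0 ] :* a))) refl a b r)
          0≤w))
        ≤-refl
        (inj₂ (0<-⇒< (<-respʳ
          (solve 3 (λ a b r → let b′ = b :+ (con (+ 2) :+ r) :* a in
              a :+ (a :+ (b :+ b) :+ (a :+ (r :* a :+ r :* a))) := (b′ :+ b′) :- a) refl a b r)
          (0<x+y 0<a (0≤x+y 0≤a+2b (0≤x+y (<⇒≤ 0<a) (0≤x+y 0≤ra 0≤ra)))))))))
      where
      r : Carrier
      r = fromℕ n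
      0≤r : 0# ≤ r
      0≤r = 0≤fromℕ n
      0≤ra : 0# ≤ r * a
      0≤ra = *-nonneg 0≤r (<⇒≤ 0<a)
      0≤w : 0# ≤ (a + (b + b)) + r * a
      0≤w = 0≤x+y 0≤a+2b 0≤ra
    first-tracks-equal {F@(form a b c)} y@(-[1+ n ]) (properForm 0<a _ 0<a-2b) _ _ _ =
      inj₂ (dominates-respˡ (flip-cong (next-cong (-‿cong (sym (fromℤ-+ (+ 1) (+ n)))) (≋-refl {F}))) (dominates
        (0≤-⇒≤ (≤-respʳ
          (solve 4 (λ a b c r → let t = :- (con (+ 1) :+ r) ; s = con -[1+ 0 ] in
            r :* (a :- (b :+ b)) :+ (r :* a :+ r :* (r :* a))
            := (c :+ (t :* b :+ t :* b) :+ t :* t :* a) :- (c :+ (s :* b :+ s :* b) :+ s :* s :* a)) refl a b c r)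
          (0≤x+y (*-nonneg 0≤r (<⇒≤ 0<a-2b)) (0≤x+y 0≤ra (*-nonneg 0≤r 0≤ra)))))
        (0≤-⇒≤ (≤-respʳ
          (solve 3 (λ a b r → r :* a
            := (:- (b :+ (:- (con (+ 1) :+ r)) :* a)) :- (:- (b :+ con -[1+ 0 ] :* a))) refl a b r)
          0≤ra))
        ≤-refl
        (inj₂ (0<-⇒< (<-respʳ
          (solve 3 (λ a b r → let b′ = :- (b :+ (:- (con (+ 1) :+ r)) :* a) in
              a :- (b :+ b) :+ (r :* a :+ r :* a) := (b′ :+ b′) :- a) refl a b r)
          (0<x+y 0<a-2b (0≤x+y 0≤ra 0≤ra)))))))
      where
      r : Carrier
      r = fromℕ n
      0≤r : 0# ≤ r
      0≤r = 0≤fromℕ n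
      0≤ra : 0# ≤ r * a
      0≤ra = *-nonneg 0≤r (<⇒≤ 0<a)

    next-flip-grow : ∀ {F G} → F ≋ flip G → next (fromℤ -[1+ 1 ]) F ≋ flip (grow G)
    next-flip-grow {G = G} e = ≋-trans (next-cong refl e) (next-flip G refl)

  dominates-respʳ : ∀ {F G G′} → G ≋ G′ → Dominates F G → Dominates F G′
  dominates-respʳ (mk≋ p q r) (dominates u v w z) = dominates
    (≤-respˡ p u) (≤-respˡ q v) (≤-respˡ r w) z

  tracks-respʳ : ∀ {F G G′} → G ≋ G′ → Tracks F G → Tracks F G′
  tracks-respʳ e = Sum.map (dominates-respʳ e) (dominates-respʳ e)

  -- Words acting on forms, and powers of the extremal blocks.

  grow^ : ℕ → Form → Form
  grow^ zero    G = G
  grow^ (suc j) G = grow (grow^ j G)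

  actᶠ : Letter → Form → Form
  actᶠ S      = exchange
  actᶠ (T^ x) = translate (fromℤ x)

  infixr 7 _⊙ᶠ_
  _⊙ᶠ_ : Word → Form → Form
  w ⊙ᶠ F = foldr actᶠ F w

  actᶠ-cong : ∀ l {F G} → F ≋ G → actᶠ l F ≋ actᶠ l G
  actᶠ-cong S      = exchange-cong
  actᶠ-cong (T^ x) = translate-cong refl

  power-ST² : ∀ j w F → (ST^ (+ 2) ^ j ++ w) ⊙ᶠ F ≋ grow^ j (w ⊙ᶠ F)
  power-ST² zero    w F = ≋-refl
  power-ST² (suc j) w F = next-cong refl (power-ST² j w F)

  -- Each block is `grow` conjugated by `flip`; the inner flips cancel in pairs and one remains at
  -- either end.
  power-ST⁻² : ∀ j w F → (ST^ -[1+ 1 ] ^ j ++ w) ⊙ᶠ F ≋ flip (grow^ j (flip (w ⊙ᶠ F)))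
  power-ST⁻² zero    w F = ≋-sym (flip-involutive _)
  power-ST⁻² (suc j) w F = next-flip-grow (power-ST⁻² j w F)

-- From bases, norms and m to Gram forms.

module GramForms {ℓ ℓ₁ ℓ₂} (ℝ : RealField ℓ ℓ₁ ℓ₂) where

  open RealField ℝ hiding (zero)
  open RealFieldProperties ℝ
  open LatticeReduction ℝ renaming (ℓ to length)
  open OrderProperties ℝ
  open Forms ℝ
  open Solver using (solve; _:=_; _:+_; _:*_; _:-_; :-_; con)

  gram : Basis → Form
  gram B = form (b₁ B ∙ b₁ B) (b₂ B ∙ b₁ B) (b₂ B ∙ b₂ B)

  abstract
    gram-act : ∀ l B → gram (act l B) ≋ actᶠ l (gram B)
    gram-act S (basis ((x , y) , (u , v)) _) = mk≋
      (solve 4 (λ x y u v → let e = con (+ 0) :* x :+ con (+ 1) :* u ; f = con (+ 0) :* y :+ con (+ 1) :* v in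
        e :* e :+ f :* f := u :* u :+ v :* v) refl x y u v)
      (solve 4 (λ x y u v → let
          e = con (+ 0) :* x :+ con (+ 1) :* u ; f = con (+ 0) :* y :+ con (+ 1) :* v
          g = con (+ 1) :* x :+ con (+ 0) :* u ; h = con (+ 1) :* y :+ con (+ 0) :* v in
        g :* e :+ h :* f := u :* x :+ v :* y) refl x y u v)
      (solve 4 (λ x y u v → let g = con (+ 1) :* x :+ con (+ 0) :* u ; h = con (+ 1) :* y :+ con (+ 0) :* v in
        g :* g :+ h :* h := x :* x :+ y :* y) refl x y u v)
    gram-act (T^ i) (basis ((x , y) , (u , v)) _) = mk≋
      (solve 4 (λ x y u v → let e = con (+ 1) :* x :+ con (+ 0) :* u ; f = con (+ 1) :* y :+ con (+ 0) :* v in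
        e :* e :+ f :* f := x :* x :+ y :* y) refl x y u v)
      (solve 5 (λ x y u v t → let
          e = con (+ 1) :* x :+ con (+ 0) :* u ; f = con (+ 1) :* y :+ con (+ 0) :* v
          g = t :* x :+ con (+ 1) :* u ; h = t :* y :+ con (+ 1) :* v in
        g :* e :+ h :* f := (u :* x :+ v :* y) :+ t :* (x :* x :+ y :* y)) refl x y u v (fromℤ i))
      (solve 5 (λ x y u v t → let
          g = t :* x :+ con (+ 1) :* u ; h = t :* y :+ con (+ 1) :* v ; b = u :* x :+ v :* y in
        g :* g :+ h :* h := (u :* u :+ v :* v) :+ (t :* b :+ t :* b) :+ t :* t :* (x :* x :+ y :* y))
        refl x y u v (fromℤ i))

    gram-⊙ : ∀ w B → gram (w ⊙ B) ≋ w ⊙ᶠ gram B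
    gram-⊙ []      B = ≋-refl
    gram-⊙ (l ∷ w) B = ≋-trans (gram-act l (w ⊙ B)) (actᶠ-cong l (gram-⊙ w B))

    norm-square : ∀ v → ∣ v ∣ * ∣ v ∣ ≈ v ∙ v
    norm-square (x , y) = √-square _ _

    norm-nonneg : ∀ v → 0# ≤ ∣ v ∣
    norm-nonneg (x , y) = √-nonneg _ _

    norm-<⇒ : ∀ {u v} → ∣ u ∣ < ∣ v ∣ → u ∙ u < v ∙ v
    norm-<⇒ {u} {v} p = <-respˡ (norm-square u) (<-respʳ (norm-square v) (square-mono-< (norm-nonneg u) p))

    norm-≈⇒ : ∀ {u v} → ∣ u ∣ ≈ ∣ v ∣ → u ∙ u ≈ v ∙ v
    norm-≈⇒ {u} {v} p = trans (sym (norm-square u)) (trans (*-cong p p) (norm-square v))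

    length≈size : ∀ B → length B ≈ size (gram B)
    length≈size B = +-cong (norm-square (b₁ B)) (norm-square (b₂ B))

    b₁∙b₁>0 : ∀ B → 0# < b₁ B ∙ b₁ B
    b₁∙b₁>0 B = 0≤#0⇒0< (0≤x+y (0≤x² _) (0≤x² _)) (b₁∙b₁#0 B)

    m-numerator : ∀ B → m B * (b₁ B ∙ b₁ B) ≈ b₂ B ∙ b₁ B
    m-numerator B = trans
      (solve 3 (λ b i a → b :* i :* a := b :* (a :* i)) refl (b₂ B ∙ b₁ B) (a ⁻¹⟨ b₁∙b₁#0 B ⟩) a)
      (trans (*-congˡ (*-inverseʳ a _)) (*-identityʳ _))
      where
      a : Carrier
      a = b₁ B ∙ b₁ B

    -- The positive factor `2a` clears the denominator of `m` and the one in `½` at once, so bounds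
    -- on `m` become linear in the Gram entries.
    a+2b≈ : ∀ B → let F = gram B in
      (m B - - ½) * (Form.a F + Form.a F) ≈ Form.a F + (Form.b F + Form.b F)
    a+2b≈ B = trans
      (solve 3 (λ m h a → (m :- (:- h)) :* (a :+ a) := a :* ((con (+ 1) :+ con (+ 1)) :* h) :+ (m :* a :+ m :* a))
        refl (m B) ½ (b₁ B ∙ b₁ B))
      (+-cong (trans (*-congˡ (*-inverseʳ _ _)) (*-identityʳ _)) (+-cong (m-numerator B) (m-numerator B)))

    a-2b≈ : ∀ B → let F = gram B in
      (½ - m B) * (Form.a F + Form.a F) ≈ Form.a F - (Form.b F + Form.b F)
    a-2b≈ B = trans
      (solve 3 (λ m h a → (h :- m) :* (a :+ a) := a :* ((con (+ 1) :+ con (+ 1)) :* h) :- (m :* a :+ m :* a))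
        refl (m B) ½ (b₁ B ∙ b₁ B))
      (+-cong (trans (*-congˡ (*-inverseʳ _ _)) (*-identityʳ _))
        (-‿cong (+-cong (m-numerator B) (m-numerator B))))

    2a>0 : ∀ B → 0# < b₁ B ∙ b₁ B + b₁ B ∙ b₁ B
    2a>0 B = 0<x+y (b₁∙b₁>0 B) (<⇒≤ (b₁∙b₁>0 B))

    proper⇒properForm : ∀ {B} → Proper B → ProperForm (gram B)
    proper⇒properForm {B} (-½≤m , m<½) = properForm (b₁∙b₁>0 B)
      (≤-respʳ (a+2b≈ B) (*-nonneg (≤⇒0≤- -½≤m) (<⇒≤ (2a>0 B))))
      (<-respʳ (a-2b≈ B) (*-pos (<⇒0<- m<½) (2a>0 B)))

    length-⊙≈size : ∀ w R → length (w ⊙ R) ≈ size (w ⊙ᶠ gram R)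
    length-⊙≈size w R = trans (length≈size (w ⊙ R)) (size-cong (gram-⊙ w R))

  -- Runs of the algorithm, read on Gram forms.

  gaussianWord : ℕ → (ℕ → ℤ) → Word
  gaussianWord k x = T^ (x (suc k)) ∷ ∏ST^ k x

  module _ (F : Form) (x : ℕ → ℤ) where

    -- For a Gaussian word with k swaps, this is the form reached once the algorithm has undone the
    -- outermost translation.
    swapped : ℕ → Form
    swapped k = ∏ST^ k x ⊙ᶠ F

    -- What one swap of a run reveals. The remaining input `B` is known through its Gram form only,
    -- because undoing a letter restores a basis merely up to `≈`.
    record Step (j : ℕ) : Set (ℓ ⊔ ℓ₁ ⊔ ℓ₂) where
      constructor step
      field
        proper     : ProperForm (swapped (suc j))
        descending : Descending (swapped (suc j))
        B          : Basis
        gram≋      : gram B ≋ gaussianWord j x ⊙ᶠ F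
        run        : B ⇝ gaussianWord j x

    gaussian-step : ∀ j B → gram B ≋ gaussianWord (suc j) x ⊙ᶠ F → B ⇝ gaussianWord (suc j) x → Step j
    gaussian-step j B e (swap _ prop desc run) = step
      (proper-resp e′ (proper⇒properForm {B′} prop))
      (descending-resp e′ (norm-<⇒ {b₂ B′} {b₁ B′} desc))
      -- The algorithm's swap and the leading `S` of the word cancel by computation on forms.
      (act S B′) (≋-trans (gram-act S B′) (exchange-cong e′)) run
      where
      y : ℤ
      y = x (suc (suc j))
      B′ : Basis
      B′ = act (T^ (ℤ.- y)) B
      e′ : gram B′ ≋ swapped (suc j)
      e′ = ≋-trans (gram-act (T^ (ℤ.- y)) B) (≋-trans (translate-cong refl e)
        (translate-inverse (swapped (suc j)) (fromℤ-neg y)))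

    -- A run meets the swapped forms in order of decreasing index, while tracking starts at
    -- `swapped 1`; the recursion consumes the run and builds the comparison on the way back.
    -- Properness and descent are returned too, since the next step needs them for both of its
    -- forms.
    gaussian-tracks : ∀ {G} →
      (ProperForm (swapped 1) → Descending (swapped 1) → Tracks (swapped 1) G) →
      ∀ j B → gram B ≋ gaussianWord (suc j) x ⊙ᶠ F → B ⇝ gaussianWord (suc j) x →
      ProperForm (swapped (suc j)) × Descending (swapped (suc j)) × Tracks (swapped (suc j)) (grow^ j G)
    gaussian-tracks first zero B e run =
      let step p d _ _ _ = gaussian-step zero B e run in p , d , first p d
    gaussian-tracks first (suc j) B e run =
      let step p d B′ e′ run′ = gaussian-step (suc j) B e run
          p′ , d′ , t′ = gaussian-tracks first j B′ e′ run′
      in p , d , next-tracks (x (suc (suc j))) (proper⇒balanced p′) d′ (proper⇒balanced p) d t′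

  -- The seed `G` accounts for the first of the `suc j` swaps, which leaves j growth steps.
  gaussian-size : ∀ {R G} x j → Gaussian R (gaussianWord (suc j) x) →
    (ProperForm (swapped (gram R) x 1) → Descending (swapped (gram R) x 1) → Tracks (swapped (gram R) x 1) G) →
    size (grow^ j G) ≤ length (gaussianWord (suc j) x ⊙ R)
  gaussian-size {R} x j run first =
    let p , _ , t = gaussian-tracks (gram R) x first j _ (gram-⊙ (gaussianWord (suc j) x) R) run in
    ≤-respʳ (sym (length-⊙≈size (gaussianWord (suc j) x) R))
      (≤-trans (tracks-size t) (size≤translate (x (suc (suc j))) (proper⇒balanced p)))

  length-ST² : ∀ j w R → length ((ST^ (+ 2) ^ j ++ w) ⊙ R) ≈ size (grow^ j (w ⊙ᶠ gram R))
  length-ST² j w R = trans (length-⊙≈size (ST^ (+ 2) ^ j ++ w) R) (size-cong (power-ST² j w (gram R)))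

  length-ST⁻² : ∀ j w R → length ((ST^ -[1+ 1 ] ^ j ++ w) ⊙ R) ≈ size (grow^ j (flip (w ⊙ᶠ gram R)))
  length-ST⁻² j w R = trans (length-⊙≈size (ST^ -[1+ 1 ] ^ j ++ w) R) (size-cong (power-ST⁻² j w (gram R)))

  -- The four cases for the reduced basis.

  module _ (R : Basis) (reduced : Reduced R) (x : ℕ → ℤ) (j : ℕ) (run : Gaussian R (gaussianWord (suc j) x)) where

    private
      F : Form
      F = gram R
      open Form F
      prop : ProperForm F
      prop = proper⇒properForm {R} (proj₁ reduced)
      open ProperForm prop

    abstract
      -- For b ≥ 0 the seed with middle entry `-|b|` is the flip of the form of `SR`, and the flip
      -- turns growth by 2 into blocks with exponent -2.
      bound-m≥0 : 0# ≤ m R → length ((ST^ -[1+ 1 ] ^ j ++ S ∷ []) ⊙ R) ≤ length (gaussianWord (suc j) x ⊙ R)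
      bound-m≥0 0≤m = ≤-respˡ (sym (length-ST⁻² j _ R)) (gaussian-size x j run (λ _ _ →
        first-tracks (x 1) prop
          (0≤-⇒≤ (≤-respʳ (solve 1 (λ b → b :+ b := b :- :- b) refl b) (0≤x+y 0≤b 0≤b)))
          ≤-refl (inj₂ refl) (inj₁ (0<x+y 0<a (0≤x+y 0≤b 0≤b)))))
        where
        0≤b : 0# ≤ b
        0≤b = ≤-respʳ (m-numerator R) (*-nonneg 0≤m (<⇒≤ 0<a))

      -- For b < 0 the form of `SR` has middle entry `-|b|` already, so the exponent stays 2.
      bound-m<0 : - ½ < m R → m R < 0# →
        length ((ST^ (+ 2) ^ j ++ S ∷ []) ⊙ R) ≤ length (gaussianWord (suc j) x ⊙ R)
      bound-m<0 -½<m m<0 = ≤-respˡ (sym (length-ST² j _ R)) (gaussian-size x j run (λ _ _ →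
        first-tracks (x 1) prop ≤-refl
          (0≤-⇒≤ (≤-respʳ (solve 1 (λ b → :- b :+ :- b := :- b :- b) refl b) (0≤x+y 0≤-b 0≤-b)))
          (inj₁ refl) (inj₁ (<-respʳ (a+2b≈ R) (*-pos (<⇒0<- -½<m) (2a>0 R))))))
        where
        0≤-b : 0# ≤ - b
        0≤-b = ≤-respʳ (trans (solve 2 (λ m a → (con (+ 0) :- m) :* a := :- (m :* a)) refl (m R) a)
          (-‿cong (m-numerator R))) (*-nonneg (<⇒≤ (<⇒0<- m<0)) (<⇒≤ 0<a))

      -- Here `a + 2b = 0`, so `STR` has the form `(c , -b , a)`, and its flip is again the seed
      -- with middle entry `-|b|`.
      bound-m≈-½ : m R ≈ - ½ →
        length ((ST^ -[1+ 1 ] ^ j ++ ST^ (+ 1)) ⊙ R) ≤ length (gaussianWord (suc j) x ⊙ R)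
      bound-m≈-½ m≈-½ = ≤-respˡ (sym (length-ST⁻² j _ R)) (gaussian-size x j run (λ _ _ →
        tracks-respʳ seed≋ (first-tracks (x 1) prop ≤-refl
          (0≤-⇒≤ (≤-respʳ
            (trans (solve 2 (λ a b → a := (:- b :- b) :+ (a :+ (b :+ b))) refl a b)
              (trans (+-congˡ a+2b≈0) (+-identityʳ _)))
            (<⇒≤ 0<a)))
          (inj₁ refl) (inj₂ a+2b≈0))))
        where
        a+2b≈0 : a + (b + b) ≈ 0#
        a+2b≈0 = trans (sym (a+2b≈ R)) (trans (*-congʳ (trans (+-congʳ m≈-½)
          (-‿inverseʳ (- ½)))) (zeroˡ _))
        seed≋ : form c b a ≋ flip (next (fromℤ (+ 1)) F)
        seed≋ = mk≋
          (sym (trans (solve 3 (λ a b c → let t = con (+ 1) in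
              (c :+ (t :* b :+ t :* b) :+ t :* t :* a) := c :+ (a :+ (b :+ b))) refl a b c)
            (trans (+-congˡ a+2b≈0) (+-identityʳ _))))
          (trans (solve 2 (λ a b → b := :- (b :+ con (+ 1) :* a) :+ (a :+ (b :+ b))) refl a b)
            (trans (+-congˡ a+2b≈0) (+-identityʳ _)))
          refl

      bound-equal : ∣ b₁ R ∣ ≈ ∣ b₂ R ∣ →
        length ((ST^ -[1+ 1 ] ^ j ++ ST^ -[1+ 0 ]) ⊙ R) ≤ length (gaussianWord (suc j) x ⊙ R)
      bound-equal e = ≤-respˡ (sym (length-ST⁻² j _ R)) (gaussian-size x j run (λ p d →
        first-tracks-equal (x 1) prop (norm-≈⇒ {b₁ R} {b₂ R} e) p d))

theorem5 : ∀ {c ℓ₁ ℓ₂} (ℝ : RealField c ℓ₁ ℓ₂) →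
    let open RealField ℝ
        open RealFieldProperties ℝ
        open LatticeReduction ℝ in
    (R : Basis) → Reduced R →
    (k : ℕ) .{{_ : NonZero k}} (x : ℕ → ℤ) →
    let ω = T^ (x (suc k)) ∷ ∏ST^ k x in
    Gaussian R ω →
    (∣ b₁ R ∣ < ∣ b₂ R ∣ → 0# ≤ m R →
       ℓ ((ST^ -[1+ 1 ] ^ (k ∸ 1) ++ S ∷ []) ⊙ R) ≤ ℓ (ω ⊙ R)) ×
    (∣ b₁ R ∣ < ∣ b₂ R ∣ → - ½ < m R → m R < 0# →
       ℓ ((ST^ (+ 2) ^ (k ∸ 1) ++ S ∷ []) ⊙ R) ≤ ℓ (ω ⊙ R)) ×
    (∣ b₁ R ∣ < ∣ b₂ R ∣ → m R ≈ - ½ →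
       ℓ ((ST^ -[1+ 1 ] ^ (k ∸ 1) ++ ST^ (+ 1)) ⊙ R) ≤ ℓ (ω ⊙ R)) ×
    (∣ b₁ R ∣ ≈ ∣ b₂ R ∣ →
       ℓ ((ST^ -[1+ 1 ] ^ (k ∸ 1) ++ ST^ -[1+ 0 ]) ⊙ R) ≤ ℓ (ω ⊙ R))
-- Since k is nonzero it is `suc j`, and `k ∸ 1` computes to j.
theorem5 ℝ R reduced (suc j) x run =
  (λ _ → bound-m≥0 R reduced x j run) ,
  (λ _ → bound-m<0 R reduced x j run) ,
  (λ _ → bound-m≈-½ R reduced x j run) ,
  bound-equal R reduced x j run
  where open GramForms ℝ
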